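{- Let $(\Omega; P_1,\ldots,P_n)$ be a countable proper colored $D$-set. Then $(\Omega; D, P_1,\ldots,P_n)$ is ultrahomogeneous if and only if $\Omega$ is dense and regular and, for every infinite sector $\Sigma$ of every splitting of $\Omega$ and for every color $i\in\{1,\ldots,n\}$, we have $\Sigma\cap P_i\neq\emptyset$.
   Context: A $D$-set is a set $\Omega$ with a quaternary relation $D$, written $D(wx;yz)$ or $wx|yz$, such that for all $w,x,y,z\in\Omega$: (D1) $D(wx;yz)\to (D(xw;yz)\wedge D(yz;wx))$; (D2) $D(wx;yz)\to\neg D(wy;xz)$; (D3) $D(wx;yz)\to\forall v\,(D(vx;yz)\vee D(wx;yv))$; (D4) $(w\neq y\wedge x\neq y)\to D(wx;yy)$. It is proper if $|\Omega|\ge 3$ and (D5) whenever $w,x,y$ are pairwise distinct there is $z\neq y$ with $D(wx;yz)$. It is dense if $|\Omega|\ge2$ and (D6) $D(wx;yz)$ implies there is $v$ with $D(vx;yz)\wedge D(wv;yz)\wedge D(wx;vz)\wedge D(wx;yv)$. A splitting of $\Omega$ is a partition of $\Omega$ into at least two parts (called sectors) such that (i) if $a,b$ lie in a part $\Sigma$ and $c,d\in\Omega\setminus\Sigma$ then $D(ab;cd)$, and (ii) if $a,b,c,d$ lie in four distinct parts then $\neg D(ab;cd)$. A sector is a member of some splitting. A node splitting is a splitting with more than two sectors. $\Omega$ is regular if all node splittings of $\Omega$ have the same cardinality. A colored $D$-set is a $D$-set together with finitely many unary predicates $P_1,\dots,P_n$ whose interpretations form a partition of $\Omega$ into nonempty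 sets; $x$ has color $i$ if $x\in P_i$. A structure is ultrahomogeneous if every isomorphism between finitely generated substructures extends to an automorphism. -}

module Defs where

open import Data.Nat using (ℕ)
open import Data.Fin using (Fin)
open import Data.List using (List)
open import Data.List.Membership.Propositional using (_∈_; _∉_)
open import Data.Product using (Σ; ∃; ∃-syntax; _×_; _,_)
open import Data.Sum using (_⊎_)
open import Relation.Nullary using (¬_)
open import Relation.Binary.PropositionalEquality using (_≡_; _≢_)
open import Function.Bundles using (_↔_; _↣_; _⇔_; Inverse)

-- Quaternary relations:  D w x y z  stands for  D(wx;yz)  (= wx|yz).

Rel₄ : Set → Set₁
Rel₄ Ω = Ω → Ω → Ω → Ω → Set

record IsDSet {Ω : Set} (D : Rel₄ Ω) : Set where
  field
    D1 : ∀ {w x y z} → D w x y z → D x w y z × D y z w x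
    D2 : ∀ {w x y z} → D w x y z → ¬ D w y x z
    D3 : ∀ {w x y z} → D w x y z → ∀ v → D v x y z ⊎ D w x y v
    D4 : ∀ {w x y} → w ≢ y → x ≢ y → D w x y y

AtLeast2 : Set → Set
AtLeast2 Ω = Σ Ω λ a → Σ Ω λ b → a ≢ b

AtLeast3 : Set → Set
AtLeast3 Ω = Σ Ω λ a → Σ Ω λ b → Σ Ω λ c → (a ≢ b × a ≢ c × b ≢ c)

Proper : {Ω : Set} → Rel₄ Ω → Set
Proper {Ω} D = AtLeast3 Ω ×
  (∀ w x y → w ≢ x → w ≢ y → x ≢ y → ∃[ z ] (z ≢ y × D w x y z))

Dense : {Ω : Set} → Rel₄ Ω → Set
Dense {Ω} D = AtLeast2 Ω ×
  (∀ {w x y z} → D w x y z →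
     ∃[ v ] (D v x y z × D w v y z × D w x v z × D w x y v))

-- Splittings.  A partition of Ω is given by an index type I of parts
-- and a surjective map  part : Ω → I ; the parts (sectors) are the
-- fibres of  part .  Its cardinality is the cardinality of I.

record Splitting {Ω : Set} (D : Rel₄ Ω) (I : Set) (part : Ω → I) : Set where
  field
    surjective : ∀ i → ∃[ x ] (part x ≡ i)
    twoParts   : Σ I λ i → Σ I λ j → i ≢ j
    split-i    : ∀ a b c d → part a ≡ part b → part c ≢ part a →
                 part d ≢ part a → D a b c d
    split-ii   : ∀ a b c d → part a ≢ part b → part a ≢ part c →
                 part a ≢ part d → part b ≢ part c → part b ≢ part d →
                 part c ≢ part d → ¬ D a b c d

MoreThanTwo : Set → Set
MoreThanTwo I = Σ I λ i → Σ I λ j → Σ I λ k → (i ≢ j × i ≢ k × j ≢ k)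

Regular : {Ω : Set} → Rel₄ Ω → Set₁
Regular {Ω} D =
  ∀ (I J : Set) (p : Ω → I) (q : Ω → J) →
  Splitting D I p → MoreThanTwo I →
  Splitting D J q → MoreThanTwo J →
  I ↔ J

Finite : {Ω : Set} → (Ω → Set) → Set
Finite {Ω} S = Σ (List Ω) λ l → (∀ (x : Ω) → S x → x ∈ l)

Infinite : {Ω : Set} → (Ω → Set) → Set
Infinite S = ¬ Finite S

-- Colored D-sets: the predicates P_1..P_n partition Ω into nonempty
-- sets; this is recorded by a colouring  col : Ω → Fin n  (x ∈ P_i iff
-- col x ≡ i) which is surjective.

Colouring : Set → ℕ → Set
Colouring Ω n = Σ (Ω → Fin n) (λ col → ∀ i → ∃[ x ] (col x ≡ i))

Countable : Set → Set
Countable Ω = Ω ↣ ℕ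

-- Ultrahomogeneity of (Ω; D, P_1..P_n).  The signature is relational,
-- so finitely generated substructures are finite subsets.  An
-- isomorphism between finite substructures is given by two enumerations
-- a, b : Fin m → Ω such that a k ↦ b k is a well-defined bijection
-- preserving D and the colours in both directions.

IsPartialIso : {Ω : Set} {n : ℕ} → Rel₄ Ω → (Ω → Fin n) →
               {m : ℕ} → (Fin m → Ω) → (Fin m → Ω) → Set
IsPartialIso D col {m} a b =
  (∀ i j → (a i ≡ a j) ⇔ (b i ≡ b j)) ×
  (∀ i → col (a i) ≡ col (b i)) ×
  (∀ i j k l → D (a i) (a j) (a k) (a l) ⇔ D (b i) (b j) (b k) (b l))

IsAutomorphism : {Ω : Set} {n : ℕ} → Rel₄ Ω → (Ω → Fin n) → Ω ↔ Ω → Set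
IsAutomorphism D col g =
  (∀ x → col (Inverse.to g x) ≡ col x) ×
  (∀ w x y z → D w x y z ⇔
     D (Inverse.to g w) (Inverse.to g x) (Inverse.to g y) (Inverse.to g z))

Ultrahomogeneous : {Ω : Set} {n : ℕ} → Rel₄ Ω → (Ω → Fin n) → Set
Ultrahomogeneous {Ω} D col =
  ∀ (m : ℕ) (a b : Fin m → Ω) → IsPartialIso D col a b →
  Σ (Ω ↔ Ω) (λ g → IsAutomorphism D col g × (∀ i → Inverse.to g (a i) ≡ b i))

{-# OPTIONS --safe #-}
module Submission where

open import Defs
open import Level using (0ℓ)
open import Data.Nat using (ℕ; zero; suc; _+_; _*_; _<_; _≤_; z≤n; s≤s; _≤′_; ≤′-refl; ≤′-step; _⊔_)
open import Data.Nat.Properties using (≤⇒≤′; ≤-trans; ≤-antisym; ≮⇒≥; n<1+n; n≤1+n; *-monoʳ-≤; *-suc; m≤m⊔n; m≤n⊔m)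
open import Data.Nat.Induction using (<-wellFounded)
open import Induction.WellFounded using (Acc; acc)
open import Data.Bool using (Bool; true; false)
open import Data.Bool.Properties using (¬-not; not-injective)
open import Data.Fin using (Fin; zero; suc; toℕ)
open import Data.Fin.Properties using (pigeonhole) renaming (_≟_ to _≟ᶠ_)
open import Data.List using ([]; _∷_)
open import Data.List.Membership.Propositional using (_∈_)
open import Data.List.Relation.Unary.Any using (here; tail)
open import Data.Vec.Functional using () renaming (_∷_ to _∷ᵛ_; [] to []ᵛ)
open import Data.Product using (Σ; ∃; ∃-syntax; _×_; _,_; proj₁; proj₂)
open import Data.Sum using (_⊎_; inj₁; inj₂)
open import Data.Empty using (⊥; ⊥-elim)
open import Relation.Nullary using (¬_; Dec; yes; no; does)
open import Relation.Binary.PropositionalEquality using (_≡_; _≢_; refl; sym; trans; cong; subst)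
open import Function.Base using (_∘_)
open import Function.Bundles using (_⇔_; _↔_; Equivalence; Inverse; Injection; mk⇔; mk↔ₛ′)
open import Axiom.ExcludedMiddle using (ExcludedMiddle)
open import Axiom.UniquenessOfIdentityProofs.WithK using (uip)

-- A D-set is the set of leaves of a tree-like structure, and properness makes every branch at a
-- node infinite.  If Ω is ultrahomogeneous and an infinite sector misses a colour, carried by x,
-- then the sector contains p, q, r with xp|qr and p, r of equal colour; exchanging p and r moves x
-- into the sector.  So infinite sectors meet every colour: density follows by moving (w, x, y′, z′)
-- to (w, x, y, z) for suitable y′, z′ beyond y, and regularity by moving a monochromatic triple at
-- one node to such a triple at another.  Conversely, a point x is attached to the tree spanned by
-- finitely many points either inside an edge or at a node.  The corresponding place for its image
-- exists by density in the first case and, counting branches, by regularity in the second; it is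
-- filled with the right colour since branches are infinite sectors.  A back-and-forth argument
-- concludes.

open Equivalence using (to; from)

-- Triples, small pigeonhole facts and injections of index sets.

triple : {A : Set} → A → A → A → Fin 3 → A
triple u v w = u ∷ᵛ v ∷ᵛ w ∷ᵛ []ᵛ

triple-pairwise : {A : Set} (R : A → A → Set) → (∀ {x y} → R x y → R y x) →
                  ∀ {u v w} → R u v → R u w → R v w →
                  ∀ i j → i ≢ j → R (triple u v w i) (triple u v w j)
triple-pairwise R s uv uw vw zero zero i≢j = ⊥-elim (i≢j refl)
triple-pairwise R s uv uw vw zero (suc zero) i≢j = uv
triple-pairwise R s uv uw vw zero (suc (suc zero)) i≢j = uw
triple-pairwise R s uv uw vw (suc zero) zero i≢j = s uv
triple-pairwise R s uv uw vw (suc zero) (suc zero) i≢j = ⊥-elim (i≢j refl)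
triple-pairwise R s uv uw vw (suc zero) (suc (suc zero)) i≢j = vw
triple-pairwise R s uv uw vw (suc (suc zero)) zero i≢j = s uw
triple-pairwise R s uv uw vw (suc (suc zero)) (suc zero) i≢j = s vw
triple-pairwise R s uv uw vw (suc (suc zero)) (suc (suc zero)) i≢j = ⊥-elim (i≢j refl)

triple-≢ : {A : Set} {u v w : A} → u ≢ v → u ≢ w → v ≢ w →
           ∀ i j → i ≢ j → triple u v w i ≢ triple u v w j
triple-≢ = triple-pairwise _≢_ (λ p q → p (sym q))

Fin3-no-four : ∀ (i j k l : Fin 3) → i ≢ j → i ≢ k → i ≢ l → j ≢ k → j ≢ l → k ≢ l → ⊥
Fin3-no-four i j k l ij ik il jk jl kl
  with pigeonhole (n<1+n 3) (i ∷ᵛ j ∷ᵛ k ∷ᵛ l ∷ᵛ []ᵛ)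
... | zero , suc zero , _ , eq = ij eq
... | zero , suc (suc zero) , _ , eq = ik eq
... | zero , suc (suc (suc zero)) , _ , eq = il eq
... | suc zero , suc (suc zero) , _ , eq = jk eq
... | suc zero , suc (suc (suc zero)) , _ , eq = jl eq
... | suc (suc zero) , suc (suc (suc zero)) , _ , eq = kl eq
... | suc zero , suc zero , s≤s () , _
... | suc (suc zero) , suc zero , s≤s () , _
... | suc (suc zero) , suc (suc zero) , s≤s (s≤s ()) , _
... | suc (suc (suc zero)) , suc zero , s≤s () , _
... | suc (suc (suc zero)) , suc (suc zero) , s≤s (s≤s ()) , _
... | suc (suc (suc zero)) , suc (suc (suc zero)) , s≤s (s≤s (s≤s ())) , _

Bool-no-three : ∀ {p q r : Bool} → p ≢ q → p ≢ r → q ≢ r → ⊥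
Bool-no-three pq pr qr = qr (not-injective (trans (sym (¬-not pq)) (¬-not pr)))

does-true : {A : Set} (d : Dec A) → does d ≡ true → A
does-true (yes p) _ = p

does-false : {A : Set} (d : Dec A) → does d ≡ false → ¬ A
does-false (no ¬p) _ = ¬p

true-does : {A : Set} (d : Dec A) → A → does d ≡ true
true-does (yes _) _ = refl
true-does (no ¬p) p = ⊥-elim (¬p p)

false-does : {A : Set} (d : Dec A) → ¬ A → does d ≡ false
false-does (yes p) ¬p = ⊥-elim (¬p p)
false-does (no _) _ = refl

-- The iterates of a point missed by an injective self-map are distinct.
no-proper-self-injection : {I : Set} {m : ℕ} (h : I → I) → (∀ {i j} → h i ≡ h j → i ≡ j) →
                           (i₀ : I) → (∀ i → h i ≢ i₀) →
                           (g : I → Fin m) → (∀ {i j} → g i ≡ g j → i ≡ j) → ⊥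
no-proper-self-injection {I} {m} h h-inj i₀ miss g g-inj =
  let i , j , i<j , eq = pigeonhole (n<1+n m) (λ k → g (iterate (toℕ k)))
  in distinct i<j (g-inj eq)
  where
  iterate : ℕ → I
  iterate zero = i₀
  iterate (suc k) = h (iterate k)
  distinct : ∀ {s t} → s < t → iterate s ≢ iterate t
  distinct {zero} {suc t} _ e = miss (iterate t) (sym e)
  distinct {suc s} {suc t} (s≤s s<t) e = distinct s<t (h-inj e)

-- If `q` hit every `j`, choosing an index for each would inject `I` into `Fin m`, and `p` of that
-- index would be an injective self-map of `I` missing `i₀`. Branches are thus compared without
-- being counted, so infinite index sets need no separate treatment.
misses-transfer : {I J : Set} {m : ℕ} → I ↔ J → (p : Fin m → I) (q : Fin m → J) →
                  (∀ {k l} → p k ≡ p l → q k ≡ q l) → (i₀ : I) → (∀ k → p k ≢ i₀) →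
                  ¬ (∀ j → ∃ λ k → q k ≡ j)
misses-transfer {I} {J} {m} bij p q p⇒q i₀ missed hit =
  no-proper-self-injection (λ i → p (index i)) (λ e → index-injective (p⇒q e))
    i₀ (λ i → missed (index i)) index (λ e → index-injective (cong q e))
  where
  index : I → Fin m
  index i = proj₁ (hit (Inverse.to bij i))
  index-injective : ∀ {i j} → q (index i) ≡ q (index j) → i ≡ j
  index-injective {i} {j} e =
    trans (sym (Inverse.strictlyInverseʳ bij i))
      (trans (cong (Inverse.from bij)
                (trans (sym (proj₂ (hit (Inverse.to bij i)))) (trans e (proj₂ (hit (Inverse.to bij j))))))
             (Inverse.strictlyInverseʳ bij j))

Pair : {A : Set} → (A → Set) → A → A → Set
Pair Q i j = i ≢ j × Q i × Q j

module Classical (em : ExcludedMiddle 0ℓ) where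

  majority : (Q : Fin 3 → Set) → (∃ λ i → ∃ λ j → Pair Q i j) ⊎ (∃ λ i → ∃ λ j → Pair (¬_ ∘ Q) i j)
  majority Q with em {Q zero} | em {Q (suc zero)} | em {Q (suc (suc zero))}
  ... | yes p | yes q | _     = inj₁ (zero , suc zero , (λ ()) , p , q)
  ... | yes p | no _  | yes r = inj₁ (zero , suc (suc zero) , (λ ()) , p , r)
  ... | no _  | yes q | yes r = inj₁ (suc zero , suc (suc zero) , (λ ()) , q , r)
  ... | no p  | no q  | _     = inj₂ (zero , suc zero , (λ ()) , p , q)
  ... | no p  | yes _ | no r  = inj₂ (zero , suc (suc zero) , (λ ()) , p , r)
  ... | yes _ | no q  | no r  = inj₂ (suc zero , suc (suc zero) , (λ ()) , q , r)

  -- Three points in distinct branches serve as reference points: whichever branch is considered,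
  -- two of them lie outside it.
  two-avoiding : (Q : Fin 3 → Set) → (∀ i j → i ≢ j → Q i → Q j → ⊥) →
                 ∃ λ i → ∃ λ j → Pair (¬_ ∘ Q) i j
  two-avoiding Q unique with majority Q
  ... | inj₁ (i , j , i≢j , p , q) = ⊥-elim (unique i j i≢j p q)
  ... | inj₂ r = r

-- Quotient of a countable set by least representatives.

module Quotient (em : ExcludedMiddle 0ℓ) {Ω : Set} (count : Countable Ω)
                (_~_ : Ω → Ω → Set) (~-refl : ∀ {x} → x ~ x)
                (~-sym : ∀ {x y} → x ~ y → y ~ x)
                (~-trans : ∀ {x y z} → x ~ y → y ~ z → x ~ z) where

  private
    code : Ω → ℕ
    code = Injection.to count

  least : (Q : Ω → Set) → ∀ x → Q x → Acc _<_ (code x) →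
          ∃ λ r → Q r × (∀ s → Q s → code r ≤ code s)
  least Q x q (acc rs) with em {∃ λ s → Q s × code s < code x}
  ... | yes (s , qs , s<x) = least Q s qs (rs s<x)
  ... | no none = x , q , λ s qs → ≮⇒≥ (λ s<x → none (s , qs , s<x))

  leastRep : ∀ x → ∃ λ r → x ~ r × (∀ s → x ~ s → code r ≤ code s)
  leastRep x = least (x ~_) x ~-refl (<-wellFounded (code x))

  rep : Ω → Ω
  rep x = proj₁ (leastRep x)

  ~-rep : ∀ x → x ~ rep x
  ~-rep x = proj₁ (proj₂ (leastRep x))

  rep-cong : ∀ {x y} → x ~ y → rep x ≡ rep y
  rep-cong {x} {y} x~y = Injection.injective count
    (≤-antisym (proj₂ (proj₂ (leastRep x)) _ (~-trans x~y (~-rep y)))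
               (proj₂ (proj₂ (leastRep y)) _ (~-trans (~-sym x~y) (~-rep x))))

  -- A splitting needs an index type compared by propositional equality, so classes are encoded as
  -- fixed points of `rep`.
  Class : Set
  Class = Σ Ω λ r → rep r ≡ r

  Class-≡ : {c d : Class} → proj₁ c ≡ proj₁ d → c ≡ d
  Class-≡ {r , p} {.r , q} refl = cong (r ,_) (uip p q)

  class : Ω → Class
  class x = rep x , rep-cong (~-sym (~-rep x))

  class-surjective : ∀ c → ∃[ x ] (class x ≡ c)
  class-surjective (r , p) = r , Class-≡ p

  class-cong : ∀ {x y} → x ~ y → class x ≡ class y
  class-cong x~y = Class-≡ (rep-cong x~y)

  class-eq : ∀ {x y} → class x ≡ class y → x ~ y
  class-eq {x} {y} eq = ~-trans (subst (x ~_) (cong proj₁ eq) (~-rep x)) (~-sym (~-rep y))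

-- The tree behind a D-set: paths, cones and branches.

module DSet (em : ExcludedMiddle 0ℓ) {Ω : Set} {D : Rel₄ Ω} (isD : IsDSet D) where

  open IsDSet isD
  open Classical em

  swap : ∀ {w x y z} → D w x y z → D y z w x
  swap p = proj₂ (D1 p)

  flipˡ : ∀ {w x y z} → D w x y z → D x w y z
  flipˡ p = proj₁ (D1 p)

  flipʳ : ∀ {w x y z} → D w x y z → D w x z y
  flipʳ p = swap (flipˡ (swap p))

  -- If `w = y`, D2 applied to the quadruple itself, or to its swap, excludes `x = w` and `z = w`;
  -- then D4 yields `D w w x z`, which D2 forbids.
  D⇒w≢y : ∀ {w x y z} → D w x y z → w ≢ y
  D⇒w≢y {w} {x} {_} {z} p refl = D2 p (swap (D4 x≢w z≢w))
    where
    x≢w : x ≢ w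
    x≢w refl = D2 p p
    z≢w : z ≢ w
    z≢w refl = D2 (swap p) (swap p)

  D⇒x≢y : ∀ {w x y z} → D w x y z → x ≢ y
  D⇒x≢y p = D⇒w≢y (flipˡ p)

  D⇒w≢z : ∀ {w x y z} → D w x y z → w ≢ z
  D⇒w≢z p = D⇒w≢y (flipʳ p)

  D⇒x≢z : ∀ {w x y z} → D w x y z → x ≢ z
  D⇒x≢z p = D⇒w≢z (flipˡ p)

  D4ʳ : ∀ {w y z} → w ≢ y → w ≢ z → D w w y z
  D4ʳ w≢y w≢z = swap (D4 (λ e → w≢y (sym e)) (λ e → w≢z (sym e)))

  -- `D a b c d` says that the path from `c` to `d` avoids the path from `a` to `b`, and such paths
  -- compose. If D3 gave the wrong alternative both times, `D e b d c` and `D e d b c` would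
  -- contradict D2.
  glue : ∀ {a b c d e} → D a b c d → D a b d e → D a b c e
  glue {c = c} {e = e} p q with D3 p e | D3 (flipʳ q) c
  ... | inj₂ r | _ = r
  ... | inj₁ _ | inj₂ r = flipʳ r
  ... | inj₁ r | inj₁ s = ⊥-elim (D2 (flipʳ r) (flipʳ (swap s)))

  -- Seen from `w`, the paths to `p` and `x` part before those to `p` and `h`, which part before
  -- those to `p` and `z`.
  nest : ∀ {w x h p z} → D w x h p → D w h p z → D w x p z
  nest {w} {x} {h} {p} {z} q r with D3 (flipʳ q) z
  ... | inj₂ s = s
  ... | inj₁ s with D3 r x
  ...   | inj₁ t = ⊥-elim (D2 s (flipˡ (swap t)))
  ...   | inj₂ t = ⊥-elim (D2 q (flipʳ t))

  -- For distinct `w`, `x`, `y` the points `z` with `D w x y z` form the branch of `y` at the node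
  -- where the three meet: a cone seen from `w`. The smaller cone of `p` that leaves `h` outside
  -- stays within it.
  cone-⊆ : ∀ {w x y h p z} → D w x y h → D w x y p → D w h p z → D w x y z
  cone-⊆ q r s = glue r (nest (glue (flipʳ q) r) s)

  -- By D3 the path from `u` to one of `v`, `v′` avoids the paths joining `x`, `y` and `z`:
  -- otherwise `D v u y v′` and `D v′ u y v` would both hold, against D2.
  merge : ∀ {x y z u v v′} → D x y u v → D y z u v′ → D x z u v ⊎ D x z u v′
  merge {x} {y} {z} {u} {v} {v′} p q with D3 (flipʳ (flipˡ (swap p))) v′
  ... | inj₁ r = inj₂ (swap (glue (flipʳ (flipˡ r)) (swap q)))
  ... | inj₂ r with D3 (flipˡ (swap q)) v
  ...   | inj₁ s = inj₁ (swap (glue (swap p) (flipˡ s)))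
  ...   | inj₂ s = ⊥-elim (D2 (swap s) (swap r))

  -- For pairwise distinct t₀, t₁, t₂: x and y lie in the same branch at the node
  -- where t₀, t₁, t₂ meet.
  SameBranch : (Fin 3 → Ω) → Ω → Ω → Set
  SameBranch t x y = ∃ λ i → ∃ λ j → i ≢ j × D x y (t i) (t j)

  module _ {t : Fin 3 → Ω} where

    SameBranch-sym : ∀ {x y} → SameBranch t x y → SameBranch t y x
    SameBranch-sym (i , j , i≢j , p) = i , j , i≢j , flipˡ p

    private
      merged : ∀ {x z i j l} → i ≢ j → i ≢ l →
               D x z (t i) (t j) ⊎ D x z (t i) (t l) → SameBranch t x z
      merged i≢j i≢l (inj₁ r) = _ , _ , i≢j , r
      merged i≢j i≢l (inj₂ r) = _ , _ , i≢l , r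

    -- Two pairs chosen from three indices share an index, whose point plays the role of `u` in
    -- `merge`.
    SameBranch-trans : ∀ {x y z} → SameBranch t x y → SameBranch t y z → SameBranch t x z
    SameBranch-trans (i , j , i≢j , p) (k , l , k≢l , q)
      with i ≟ᶠ k | i ≟ᶠ l | j ≟ᶠ k | j ≟ᶠ l
    ... | yes refl | _ | _ | _ = merged i≢j k≢l (merge p q)
    ... | no _ | yes refl | _ | _ = merged i≢j (k≢l ∘ sym) (merge p (flipʳ q))
    ... | no _ | no _ | yes refl | _ = merged (i≢j ∘ sym) k≢l (merge (flipʳ p) q)
    ... | no _ | no _ | no _ | yes refl =
      merged (i≢j ∘ sym) (k≢l ∘ sym) (merge (flipʳ p) (flipʳ q))
    ... | no ik | no il | no jk | no jl = ⊥-elim (Fin3-no-four i j k l i≢j ik il jk jl k≢l)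

    -- By D3 the path from `x` to `y` avoids the path from `t i` to any point outside their branch;
    -- two such paths are glued at `t i`.
    SameBranch-split-i : ∀ {x y c d} → SameBranch t x y → ¬ SameBranch t x c →
                         ¬ SameBranch t x d → D x y c d
    SameBranch-split-i {x} {y} (i , j , i≢j , p) x≁c x≁d =
      glue (flipʳ (beyond x≁c)) (beyond x≁d)
      where
      beyond : ∀ {c} → ¬ SameBranch t x c → D x y (t i) c
      beyond {c} x≁c with D3 (flipˡ p) c
      ... | inj₁ r = ⊥-elim (x≁c (i , j , i≢j , flipˡ r))
      ... | inj₂ r = flipˡ r

    -- If `D a b c d` held, each `t i` would fall on the side of `c`, `d` or on that of `a`, `b`.
    -- Two of them share a side, and that pair witnesses that the two points of the other side lie
    -- in one branch.
    SameBranch-split-ii : ∀ {a b c d} → ¬ SameBranch t a b → ¬ SameBranch t c d → ¬ D a b c d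
    SameBranch-split-ii {a} {b} {c} {d} a≁b c≁d p with majority (λ i → D a b c (t i))
    ... | inj₁ (i , j , i≢j , q , r) = a≁b (i , j , i≢j , glue (flipʳ q) r)
    ... | inj₂ (i , j , i≢j , q , r) =
      c≁d (i , j , i≢j , glue (swap (near i q)) (flipʳ (swap (near j r))))
      where
      near : ∀ k → ¬ D a b c (t k) → D (t k) b c d
      near k ¬q with D3 p (t k)
      ... | inj₁ s = s
      ... | inj₂ s = ⊥-elim (¬q s)

    SameBranch-refl : (∀ i j → i ≢ j → t i ≢ t j) → ∀ {x} → SameBranch t x x
    SameBranch-refl distinct {x}
      with two-avoiding (λ i → x ≡ t i) (λ i j i≢j p q → distinct i j i≢j (trans (sym p) q))
    ... | i , j , i≢j , p , q = i , j , i≢j , D4ʳ p q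

    ¬SameBranch-apart : ∀ {i j} → i ≢ j → ¬ SameBranch t (t i) (t j)
    ¬SameBranch-apart {i} {j} i≢j (k , l , k≢l , p) =
      Fin3-no-four i j k l i≢j (λ e → D⇒w≢y p (cong t e)) (λ e → D⇒w≢z p (cong t e))
        (λ e → D⇒x≢y p (cong t e)) (λ e → D⇒x≢z p (cong t e)) k≢l

  record NodeSplitting (t : Fin 3 → Ω) : Set₁ where
    field
      Class : Set
      class : Ω → Class
      class-cong : ∀ {x y} → SameBranch t x y → class x ≡ class y
      class-eq : ∀ {x y} → class x ≡ class y → SameBranch t x y
      splitting : Splitting D Class class
      moreThanTwo : MoreThanTwo Class

  nodeSplitting : Countable Ω → (t : Fin 3 → Ω) → (∀ i j → i ≢ j → t i ≢ t j) → NodeSplitting t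
  nodeSplitting count t distinct = record
    { class-cong = class-cong
    ; class-eq = class-eq
    ; splitting = record
      { surjective = class-surjective
      ; twoParts = class (t zero) , class (t (suc zero)) , apart (λ ())
      ; split-i = λ a b c d ab ca da → SameBranch-split-i {t} (class-eq ab)
          (λ s → ca (sym (class-cong s))) (λ s → da (sym (class-cong s)))
      ; split-ii = λ a b c d ab _ _ _ _ cd →
          SameBranch-split-ii {t} (ab ∘ class-cong) (cd ∘ class-cong)
      }
    ; moreThanTwo = class (t zero) , class (t (suc zero)) , class (t (suc (suc zero))) ,
        apart (λ ()) , apart (λ ()) , apart (λ ())
    }
    where
    open Quotient em count (SameBranch t) (SameBranch-refl distinct) SameBranch-sym SameBranch-trans
    apart : ∀ {i j} → i ≢ j → class (t i) ≢ class (t j)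
    apart i≢j e = ¬SameBranch-apart {t} i≢j (class-eq e)

  -- Splittings and their sectors.

  module _ {I : Set} {part : Ω → I} (split : Splitting D I part) where

    open Splitting split

    -- If `x` and `y` lay in different parts, either all four parts would differ, against (ii), or
    -- one of `x`, `y` would share a part with `u` or `v`, and (i) would give a pairing that D2
    -- excludes.
    D⇒same-part : ∀ {x y u v} → part u ≢ part v → D x y u v → part x ≡ part y
    D⇒same-part {x} {y} {u} {v} u≢v p with em {part x ≡ part y}
    ... | yes e = e
    ... | no x≢y with em {part x ≡ part u} | em {part x ≡ part v} | em {part y ≡ part u} | em {part y ≡ part v}
    ...   | yes xu | _ | _ | _ =
      ⊥-elim (D2 p (split-i x u y v xu (λ e → x≢y (sym e)) (λ e → u≢v (trans (sym xu) (sym e)))))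
    ...   | no _ | yes xv | _ | _ =
      ⊥-elim (D2 (flipʳ p) (split-i x v y u xv (λ e → x≢y (sym e)) (λ e → u≢v (trans e xv))))
    ...   | no _ | no _ | yes yu | _ =
      ⊥-elim (D2 (flipˡ p) (split-i y u x v yu x≢y (λ e → u≢v (trans (sym yu) (sym e)))))
    ...   | no _ | no _ | no _ | yes yv =
      ⊥-elim (D2 (flipʳ (flipˡ p)) (split-i y v x u yv x≢y (λ e → u≢v (trans e yv))))
    ...   | no xu | no xv | no yu | no yv =
      ⊥-elim (split-ii x y u v x≢y xu xv yu yv u≢v p)

    -- Three points in distinct parts determine the whole partition in terms of `D`; this lets an
    -- automorphism carry one node splitting to another.
    same-part⇔SameBranch : {t : Fin 3 → Ω} → (∀ i j → i ≢ j → part (t i) ≢ part (t j)) →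
                           ∀ {x y} → part x ≡ part y ⇔ SameBranch t x y
    same-part⇔SameBranch {t} apart {x} {y} = mk⇔ ⇒ λ (i , j , i≢j , p) → D⇒same-part (apart i j i≢j) p
      where
      ⇒ : part x ≡ part y → SameBranch t x y
      ⇒ e with two-avoiding (λ i → part (t i) ≡ part x) (λ i j i≢j p q → apart i j i≢j (trans p (sym q)))
      ... | i , j , i≢j , p , q = i , j , i≢j , split-i x y (t i) (t j) e p q

  -- A cone and its complement form a splitting with two sectors; this is how a colour condition
  -- stated for sectors applies to cones.
  module ConeSplitting {w x y : Ω} (w≢x : w ≢ x) (w≢y : w ≢ y) (x≢y : x ≢ y) where

    side : Ω → Bool
    side z = does (em {D w x y z})

    y∈cone : D w x y y
    y∈cone = D4 w≢y x≢y

    separated : ∀ {a b c d} → D w x y a → D w x y b → ¬ D w x y c → ¬ D w x y d → D a b c d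
    separated {a} {b} {c} {d} a∈ b∈ c∉ d∉ =
      swap (glue (flipʳ (through a∈)) (through b∈))
      where
      pulled : ∀ {z u} → D w x y z → ¬ D w x y u → D u x y z
      pulled {z} {u} z∈ u∉ with D3 z∈ u
      ... | inj₁ r = r
      ... | inj₂ r = ⊥-elim (u∉ r)
      through : ∀ {z} → D w x y z → D c d y z
      through z∈ = swap (glue (swap (pulled z∈ c∉)) (swap (flipˡ (pulled z∈ d∉))))

    cone-splitting : Splitting D Bool side
    cone-splitting = record
      { surjective = surj
      ; twoParts = true , false , λ ()
      ; split-i = split
      ; split-ii = λ a b c d ab ac _ bc _ _ → ⊥-elim (Bool-no-three ab ac bc)
      }
      where
      surj : ∀ i → ∃[ z ] (side z ≡ i)
      surj true = y , true-does em y∈cone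
      surj false = x , false-does em (λ p → D⇒x≢z p refl)
      split : ∀ a b c d → side a ≡ side b → side c ≢ side a → side d ≢ side a → D a b c d
      split a b c d ab ca da with side a in a-eq
      ... | true = separated (does-true em a-eq) (does-true em (sym ab))
                     (λ p → ca (true-does em p)) (λ p → da (true-does em p))
      ... | false = swap (separated (does-true em (¬-not ca)) (does-true em (¬-not da))
                      (does-false em a-eq) (does-false em (sym ab)))

  -- Infinity of cones and of sectors at nodes.

  module _ (proper : Proper D) where

    private
      -- Induction on the list. If the head `h` lies in the cone, properness gives a second point
      -- `p` there, and the smaller cone of `p` that leaves `h` outside would be covered by the
      -- tail.
      cone⊈list : ∀ l {w x y} → w ≢ x → w ≢ y → x ≢ y → ¬ (∀ z → D w x y z → z ∈ l)
      cone⊈list [] {y = y} w≢x w≢y x≢y cover with cover y (D4 w≢y x≢y)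
      ... | ()
      cone⊈list (h ∷ l) {w} {x} {y} w≢x w≢y x≢y cover with em {D w x y h}
      ... | no h∉ = cone⊈list l w≢x w≢y x≢y λ z z∈ → tail (λ { refl → h∉ z∈ }) (cover z z∈)
      ... | yes h∈ with other
        where
        other : ∃ λ p → p ≢ h × D w x y p
        other with em {y ≡ h}
        ... | no y≢h = y , y≢h , D4 w≢y x≢y
        ... | yes refl = proj₂ proper w x y w≢x w≢y x≢y
      ...   | p , p≢h , p∈ =
        cone⊈list l (D⇒w≢z h∈) (D⇒w≢z p∈) (p≢h ∘ sym)
          λ z z∈ → tail (λ { refl → D⇒x≢z z∈ refl }) (cover z (cone-⊆ h∈ p∈ z∈))

    ⊇cone⇒infinite : ∀ {S : Ω → Set} {w x y} → w ≢ x → w ≢ y → x ≢ y →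
                     (∀ z → D w x y z → S z) → Infinite S
    ⊇cone⇒infinite w≢x w≢y x≢y cone⊆S (l , cover) =
      cone⊈list l w≢x w≢y x≢y λ z z∈ → cover z (cone⊆S z z∈)

    -- With `u`, `v` in two other sectors and `y` in `s`, the cone of `y` at the node of `u`, `v`,
    -- `y` stays in `s`.
    node-sector-infinite : {I : Set} {part : Ω → I} → Splitting D I part → MoreThanTwo I →
                           ∀ s → Infinite (λ x → part x ≡ s)
    node-sector-infinite {I} {part} split (i , j , k , ij , ik , jk) s
      with two-avoiding (λ m → triple i j k m ≡ s)
             (λ m m′ m≢m′ p q → triple-≢ ij ik jk m m′ m≢m′ (trans p (sym q)))
    ... | m , m′ , m≢m′ , m≢s , m′≢s
      with surjective (triple i j k m) | surjective (triple i j k m′) | surjective s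
      where open Splitting split
    ... | u , pu | v , pv | y , refl = ⊇cone⇒infinite
        (λ { refl → u≢v refl }) (λ { refl → m≢s (sym pu) }) (λ { refl → m′≢s (sym pv) })
        (λ z p → sym (D⇒same-part split u≢v (swap p)))
      where
      u≢v : part u ≢ part v
      u≢v e = triple-≢ ij ik jk m m′ m≢m′ (trans (sym pu) (trans e pv))

-- Coloured D-sets and finite partial isomorphisms.

module Coloured (em : ExcludedMiddle 0ℓ) {Ω : Set} {D : Rel₄ Ω} (isD : IsDSet D)
                {n : ℕ} (col : Ω → Fin n) where

  open IsDSet isD
  open Classical em
  open DSet em isD

  SectorsMeetAllColours : Set₁
  SectorsMeetAllColours =
    ∀ (I : Set) (part : Ω → I) → Splitting D I part →
    ∀ (s : I) → Infinite (λ x → part x ≡ s) →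
    ∀ c → ∃[ x ] (part x ≡ s × col x ≡ c)

  cone-colour : Proper D → SectorsMeetAllColours → ∀ {w x y} → w ≢ x → w ≢ y → x ≢ y →
                ∀ c → ∃[ z ] (D w x y z × col z ≡ c)
  cone-colour proper meets w≢x w≢y x≢y c
    with meets Bool side cone-splitting true
           (⊇cone⇒infinite proper w≢x w≢y x≢y (λ z → true-does em)) c
    where open ConeSplitting w≢x w≢y x≢y
  ... | z , z∈ , e = z , does-true em z∈ , e

  EqIso : ∀ {m} → (a b : Fin m → Ω) → Set
  EqIso a b = ∀ i j → (a i ≡ a j) ⇔ (b i ≡ b j)

  partialIso-sym : ∀ {m} {a b : Fin m → Ω} → IsPartialIso D col a b → IsPartialIso D col b a
  partialIso-sym (eqs , cols , Ds) =
    (λ i j → mk⇔ (from (eqs i j)) (to (eqs i j))) ,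
    (λ i → sym (cols i)) ,
    (λ i j k l → mk⇔ (from (Ds i j k l)) (to (Ds i j k l)))

  eqIso-∷ : ∀ {m} {a b : Fin m → Ω} {x y} → (∀ k → x ≢ a k) → (∀ k → y ≢ b k) →
            EqIso a b → EqIso (x ∷ᵛ a) (y ∷ᵛ b)
  eqIso-∷ x∉ y∉ eqs zero zero = mk⇔ (λ _ → refl) (λ _ → refl)
  eqIso-∷ x∉ y∉ eqs zero (suc j) = mk⇔ (λ e → ⊥-elim (x∉ j e)) (λ e → ⊥-elim (y∉ j e))
  eqIso-∷ x∉ y∉ eqs (suc i) zero = mk⇔ (λ e → ⊥-elim (x∉ i (sym e))) (λ e → ⊥-elim (y∉ i (sym e)))
  eqIso-∷ x∉ y∉ eqs (suc i) (suc j) = eqs i j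

  -- By the symmetries D1, and by D4 when the new point fills both places of one side, only
  -- quadruples with the new point in third place carry information.
  D-∷ : ∀ {m} {a b : Fin m → Ω} {x y} → (∀ k → y ≢ b k) →
        (∀ i j k l → D (a i) (a j) (a k) (a l) → D (b i) (b j) (b k) (b l)) →
        (∀ i j k → D (a i) (a j) x (a k) → D (b i) (b j) y (b k)) →
        let a⁺ = x ∷ᵛ a ; b⁺ = y ∷ᵛ b in
        ∀ i j k l → D (a⁺ i) (a⁺ j) (a⁺ k) (a⁺ l) → D (b⁺ i) (b⁺ j) (b⁺ k) (b⁺ l)
  D-∷ y∉ H H₁ zero zero zero l p = ⊥-elim (D⇒w≢y p refl)
  D-∷ y∉ H H₁ zero zero (suc k) zero p = ⊥-elim (D⇒w≢z p refl)
  D-∷ y∉ H H₁ zero zero (suc k) (suc l) p = D4ʳ (y∉ k) (y∉ l)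
  D-∷ y∉ H H₁ zero (suc j) zero l p = ⊥-elim (D⇒w≢y p refl)
  D-∷ y∉ H H₁ zero (suc j) (suc k) zero p = ⊥-elim (D⇒w≢z p refl)
  D-∷ y∉ H H₁ zero (suc j) (suc k) (suc l) p = swap (H₁ k l j (swap p))
  D-∷ y∉ H H₁ (suc i) zero zero l p = ⊥-elim (D⇒x≢y p refl)
  D-∷ y∉ H H₁ (suc i) zero (suc k) zero p = ⊥-elim (D⇒x≢z p refl)
  D-∷ y∉ H H₁ (suc i) zero (suc k) (suc l) p = flipˡ (swap (H₁ k l i (swap (flipˡ p))))
  D-∷ y∉ H H₁ (suc i) (suc j) zero zero p = D4 (y∉ i ∘ sym) (y∉ j ∘ sym)
  D-∷ y∉ H H₁ (suc i) (suc j) zero (suc l) p = H₁ i j l p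
  D-∷ y∉ H H₁ (suc i) (suc j) (suc k) zero p = flipʳ (H₁ i j k (flipʳ p))
  D-∷ y∉ H H₁ (suc i) (suc j) (suc k) (suc l) p = H i j k l p

  partialIso-∷ : ∀ {m} {a b : Fin m → Ω} {x y} → IsPartialIso D col a b → col x ≡ col y →
                 (∀ k → x ≢ a k) → (∀ k → y ≢ b k) →
                 (∀ i j k → D (a i) (a j) x (a k) → D (b i) (b j) y (b k)) →
                 (∀ i j k → D (b i) (b j) y (b k) → D (a i) (a j) x (a k)) →
                 IsPartialIso D col (x ∷ᵛ a) (y ∷ᵛ b)
  partialIso-∷ {a = a} {b} {x} {y} (eqs , cols , Ds) cxy x∉ y∉ H H′ =
    eqIso-∷ x∉ y∉ eqs , cols⁺ , λ i j k l →
      mk⇔ (D-∷ y∉ (λ i j k l → to (Ds i j k l)) H i j k l)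
          (D-∷ x∉ (λ i j k l → from (Ds i j k l)) H′ i j k l)
    where
    cols⁺ : ∀ i → col ((x ∷ᵛ a) i) ≡ col ((y ∷ᵛ b) i)
    cols⁺ zero = cxy
    cols⁺ (suc i) = cols i

  private
    -- With three indices, one side of any instance of `D` repeats an index, so the instance reduces
    -- to inequalities.
    D-degenerate : {a b : Fin 3 → Ω} → EqIso a b →
                   ∀ i j k l → D (a i) (a j) (a k) (a l) → D (b i) (b j) (b k) (b l)
    D-degenerate {a} {b} eqs i j k l p with i ≟ᶠ j | k ≟ᶠ l
    ... | yes refl | _ = D4ʳ (λ e → D⇒w≢y p (from (eqs i k) e)) (λ e → D⇒w≢z p (from (eqs i l) e))
    ... | no _ | yes refl = D4 (λ e → D⇒w≢y p (from (eqs i k) e)) (λ e → D⇒x≢y p (from (eqs j k) e))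
    ... | no i≢j | no k≢l = ⊥-elim (Fin3-no-four i j k l i≢j
      (λ e → D⇒w≢y p (cong a e)) (λ e → D⇒w≢z p (cong a e))
      (λ e → D⇒x≢y p (cong a e)) (λ e → D⇒x≢z p (cong a e)) k≢l)

  partialIso₃ : {a b : Fin 3 → Ω} → EqIso a b → (∀ i → col (a i) ≡ col (b i)) →
                IsPartialIso D col a b
  partialIso₃ eqs cols = eqs , cols , λ i j k l →
    mk⇔ (D-degenerate eqs i j k l)
        (D-degenerate (λ i j → mk⇔ (from (eqs i j)) (to (eqs i j))) i j k l)

  distinct⇒eqIso : ∀ {m} {a b : Fin m → Ω} → (∀ i j → i ≢ j → a i ≢ a j) →
                   (∀ i j → i ≢ j → b i ≢ b j) → EqIso a b
  distinct⇒eqIso a-dist b-dist i j with i ≟ᶠ j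
  ... | yes refl = mk⇔ (λ _ → refl) (λ _ → refl)
  ... | no i≢j = mk⇔ (λ e → ⊥-elim (a-dist i j i≢j e)) (λ e → ⊥-elim (b-dist i j i≢j e))

  -- R is the partition of the points a i into the branches, other than that of x, at the
  -- vertex where x is attached to the tree spanned by them.
  record Rooted {m : ℕ} (R : Fin m → Fin m → Set) (a : Fin m → Ω) (x : Ω) : Set where
    field
      separates : ∀ i j l → R i j → ¬ R i l → D (a i) (a j) x (a l)
      unresolved : ∀ i j l → ¬ R i j → ¬ R i l → ¬ R j l → ¬ D (a i) (a j) x (a l)

  module _ {m : ℕ} {R : Fin m → Fin m → Set} (R-refl : ∀ i → R i i)
           (R-sym : ∀ {i j} → R i j → R j i) (R-other : ∀ i → ∃ λ k → ¬ R i k) where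

    open Rooted

    rooted-fresh : ∀ {a x} → Rooted R a x → ∀ k → x ≢ a k
    rooted-fresh rt k e with R-other k
    ... | l , ¬r = D⇒w≢y (separates rt k k l (R-refl k) ¬r) (sym e)

    -- The pattern of `R` on `i`, `j`, `l` decides the relation, except when all three lie in one
    -- branch. Then a point `a k` of another branch stands in for `x`, and the question concerns old
    -- points only.
    rooted-transfer : ∀ {a b x y} → Rooted R a x → Rooted R b y →
                      (∀ i j k l → D (a i) (a j) (a k) (a l) → D (b i) (b j) (b k) (b l)) →
                      ∀ i j l → D (a i) (a j) x (a l) → D (b i) (b j) y (b l)
    rooted-transfer ra rb H i j l p with em {R i j} | em {R i l} | em {R j l}
    ... | yes ij | no ¬il | _ = separates rb i j l ij ¬il
    ... | yes ij | yes il | _ with R-other i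
    ...   | k , ¬ik = glue (separates rb i j k ij ¬ik)
                        (H i j k l (glue (flipʳ (separates ra i j k ij ¬ik)) p))
    rooted-transfer ra rb H i j l p | no ¬ij | yes il | _ =
      ⊥-elim (D2 (flipʳ p) (flipʳ (separates ra i l j il ¬ij)))
    rooted-transfer ra rb H i j l p | no ¬ij | no ¬il | yes jl =
      ⊥-elim (D2 (flipʳ (flipˡ p)) (flipʳ (separates ra j l i jl (¬ij ∘ R-sym))))
    rooted-transfer ra rb H i j l p | no ¬ij | no ¬il | no ¬jl =
      ⊥-elim (unresolved ra i j l ¬ij ¬il ¬jl p)

    rooted-partialIso : ∀ {a b x y} → IsPartialIso D col a b → col x ≡ col y →
                        Rooted R a x → Rooted R b y → IsPartialIso D col (x ∷ᵛ a) (y ∷ᵛ b)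
    rooted-partialIso iso cxy ra rb =
      partialIso-∷ iso cxy (rooted-fresh ra) (rooted-fresh rb)
        (rooted-transfer ra rb (λ i j k l → to (proj₂ (proj₂ iso) i j k l)))
        (rooted-transfer rb ra (λ i j k l → from (proj₂ (proj₂ iso) i j k l)))

  -- Ultrahomogeneity implies the three conditions

  module FromUltrahomogeneous (proper : Proper D) (inhabited : ∀ c → ∃[ x ] (col x ≡ c))
                              (uh : Ultrahomogeneous D col) where

    automorphism-D : ∀ {g} → IsAutomorphism D col g → ∀ {w x y z w′ x′ y′ z′} →
                     Inverse.to g w ≡ w′ → Inverse.to g x ≡ x′ →
                     Inverse.to g y ≡ y′ → Inverse.to g z ≡ z′ →
                     D w x y z → D w′ x′ y′ z′
    automorphism-D (_ , Ds) refl refl refl refl p = to (Ds _ _ _ _) p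

    -- Starting from q₀, q₁ and looking from x, each new point branches off beyond the previous ones.
    module Comb (x q₀ q₁ : Ω) (x≢q₀ : x ≢ q₀) (x≢q₁ : x ≢ q₁) (q₀≢q₁ : q₀ ≢ q₁) where

      State : Set
      State = Σ Ω λ h → Σ Ω λ p → x ≢ h × x ≢ p × h ≢ p

      beyond : (s : State) → ∃[ z ] (z ≢ proj₁ (proj₂ s) × D x (proj₁ s) (proj₁ (proj₂ s)) z)
      beyond (h , p , x≢h , x≢p , h≢p) = proj₂ proper x h p x≢h x≢p h≢p

      next : State → State
      next s@(h , p , x≢h , x≢p , h≢p) =
        let z , z≢p , d = beyond s in p , z , x≢p , D⇒w≢z d , (z≢p ∘ sym)

      state : ℕ → State
      state zero = q₀ , q₁ , x≢q₀ , x≢q₁ , q₀≢q₁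
      state (suc t) = next (state t)

      q : ℕ → Ω
      q t = proj₁ (state t)

      -- The cones along the comb decrease: `nest` followed by `glue` puts each inside the preceding
      -- one.
      q-branch : ∀ {s t z} → s ≤′ t → D x (q t) (q (suc t)) z → D x (q s) (q (suc s)) z
      q-branch ≤′-refl d = d
      q-branch {t = suc t} (≤′-step s≤t) d = q-branch {t = t} s≤t (glue e (nest e d))
        where
        e : D x (q t) (q (suc t)) (q (suc (suc t)))
        e = proj₂ (proj₂ (beyond (state t)))

      q-comb : ∀ {s r} → s < r → D x (q s) (q (suc s)) (q r)
      q-comb {s} {suc r} (s≤s s≤r) =
        let _ , _ , _ , x≢p , h≢p = state r in q-branch (≤⇒≤′ s≤r) (D4 x≢p h≢p)

    sectors-meet-all-colours : SectorsMeetAllColours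
    sectors-meet-all-colours I part split s infinite c with em {∃[ x ] (part x ≡ s × col x ≡ c)}
    ... | yes found = found
    ... | no none = ⊥-elim (contradict (inhabited c) two)
      where
      open Splitting split

      one : ∃ λ u → part u ≡ s
      one with em {∃ λ u → part u ≡ s}
      ... | yes u = u
      ... | no ¬u = ⊥-elim (infinite ([] , λ u e → ⊥-elim (¬u (u , e))))

      two : ∃ λ u → ∃ λ v → part u ≡ s × part v ≡ s × u ≢ v
      two with one
      ... | u , pu with em {∃ λ v → part v ≡ s × u ≢ v}
      ...   | yes (v , pv , u≢v) = u , v , pu , pv , u≢v
      ...   | no ¬v = ⊥-elim (infinite (u ∷ [] , λ v pv → here (equal v pv)))
        where
        equal : ∀ v → part v ≡ s → v ≡ u
        equal v pv with em {v ≡ u}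
        ... | yes e = e
        ... | no v≢u = ⊥-elim (¬v (v , pv , v≢u ∘ sym))

      contradict : (∃ λ x → col x ≡ c) → (∃ λ u → ∃ λ v → part u ≡ s × part v ≡ s × u ≢ v) → ⊥
      contradict (x , cx) (u , v , pu , pv , u≢v) =
        -- Among `n + 1` even positions two share a colour, and an odd position between them
        -- supplies the middle point `q`.
        let i , j , i<j , same-colour = pigeonhole (n<1+n n) (λ k → col (comb (2 * toℕ k)))
        in clash (toℕ i) (toℕ j) i<j same-colour
        where
        x∉ : ∀ {z} → part z ≡ s → x ≢ z
        x∉ pz refl = none (x , pz , cx)

        open Comb x u v (x∉ pu) (x∉ pv) u≢v renaming (q to comb)

        in-sector : ∀ t → part (comb t) ≡ s
        in-sector zero = pu
        in-sector (suc t) with em {part (comb (suc t)) ≡ s}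
        ... | yes e = e
        -- A comb point outside the sector would lie with `x` opposite to `u` and `v`, whereas the
        -- comb pairs `x` with `u`.
        ... | no ∉s = ⊥-elim (D2 (flipˡ (q-comb {zero} {suc t} (s≤s z≤n)))
                        (split-i u v x (comb (suc t)) (trans pu (sym pv))
                           (λ e → x∉ (trans e pu) refl) (λ e → ∉s (trans e pu))))

        -- Exchanging p and r while fixing q moves x to the other side of p, q, r, hence into the sector.
        clash : ∀ i j → i < j → col (comb (2 * i)) ≡ col (comb (2 * j)) → ⊥
        clash i j i<j same-colour =
          let g , aut , ext = uh 3 (triple p q r) (triple r q p) (partialIso₃
                (distinct⇒eqIso (triple-≢ p≢q p≢r q≢r) (triple-≢ (q≢r ∘ sym) (p≢r ∘ sym) (p≢q ∘ sym)))
                (λ { zero → same-colour ; (suc zero) → refl ; (suc (suc zero)) → sym same-colour }))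
              x′ = Inverse.to g x
              image = automorphism-D {g} aut refl (ext zero) (ext (suc zero)) (ext (suc (suc zero))) d
              out = split-i q r x x′ (trans q∈ (sym (in-sector (2 * j))))
                      (λ e → x∉ (trans e q∈) refl)
                      (λ e → none (x′ , trans e q∈ , trans (proj₁ aut x) cx))
          in D2 (glue (flipʳ (swap d)) out) (flipʳ (swap image))
          where
          step : 2 + 2 * i ≤ 2 * j
          step = subst (_≤ 2 * j) (*-suc 2 i) (*-monoʳ-≤ 2 i<j)
          p q r : Ω
          p = comb (2 * i)
          q = comb (1 + 2 * i)
          r = comb (2 * j)
          q∈ : part q ≡ s
          q∈ = in-sector (1 + 2 * i)
          d : D x p q r
          d = q-comb (≤-trans (n≤1+n _) step)
          p≢q : p ≢ q
          p≢q = D⇒x≢y d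
          p≢r : p ≢ r
          p≢r = D⇒x≢z d
          q≢r : q ≢ r
          q≢r = D⇒x≢z (q-comb step)

    -- Both partitions are given by `SameBranch` at their reference triples, and `g` carries one
    -- triple to the other; representatives turn this into maps between the index types.
    parts-↔ : {I J : Set} {p : Ω → I} {q : Ω → J} → Splitting D I p → Splitting D J q →
              {tp tq : Fin 3 → Ω} → (∀ i j → i ≢ j → p (tp i) ≢ p (tp j)) →
              (∀ i j → i ≢ j → q (tq i) ≢ q (tq j)) →
              {g : Ω ↔ Ω} → IsAutomorphism D col g → (∀ k → Inverse.to g (tp k) ≡ tq k) → I ↔ J
    parts-↔ {I} {J} {p} {q} split-p split-q {tp} {tq} apart-p apart-q {g} aut ext = mk↔ₛ′
      (λ i → q (g→ (rep-p i))) (λ j → p (g← (rep-q j)))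
      (λ j → trans (p⇒q (proj₂ (surj-p _)))
               (trans (cong q (Inverse.strictlyInverseˡ g _)) (proj₂ (surj-q j))))
      (λ i → trans (q⇒p (trans (cong q (Inverse.strictlyInverseˡ g _)) (proj₂ (surj-q _))))
               (proj₂ (surj-p i)))
      where
      surj-p : ∀ i → ∃[ x ] (p x ≡ i)
      surj-p = Splitting.surjective split-p
      surj-q : ∀ j → ∃[ x ] (q x ≡ j)
      surj-q = Splitting.surjective split-q
      rep-p : I → Ω
      rep-p i = proj₁ (surj-p i)
      rep-q : J → Ω
      rep-q j = proj₁ (surj-q j)
      g→ g← : Ω → Ω
      g→ = Inverse.to g
      g← = Inverse.from g
      p⇒q : ∀ {x y} → p x ≡ p y → q (g→ x) ≡ q (g→ y)
      p⇒q e with to (same-part⇔SameBranch split-p {tp} apart-p) e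
      ... | i , j , i≢j , d = from (same-part⇔SameBranch split-q {tq} apart-q)
        (i , j , i≢j , automorphism-D {g} aut refl refl (ext i) (ext j) d)
      q⇒p : ∀ {x y} → q (g→ x) ≡ q (g→ y) → p x ≡ p y
      q⇒p {x} {y} e with to (same-part⇔SameBranch split-q {tq} apart-q) e
      ... | i , j , i≢j , d = from (same-part⇔SameBranch split-p {tp} apart-p)
        (i , j , i≢j , from (proj₂ aut x y (tp i) (tp j))
          (subst (λ u → D (g→ x) (g→ y) u (g→ (tp j))) (sym (ext i))
            (subst (D (g→ x) (g→ y) (tq i)) (sym (ext j)) d)))

    regular : Regular D
    regular I J p q split-p many-p split-q many-q =
      let g , aut , ext = uh 3 tp tq (partialIso₃
            (distinct⇒eqIso (λ i j i≢j → apart-p i j i≢j ∘ cong p) (λ i j i≢j → apart-q i j i≢j ∘ cong q))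
            (λ k → trans (proj₂ (proj₂ (mono split-p many-p k))) (sym (proj₂ (proj₂ (mono split-q many-q k))))))
      in parts-↔ split-p split-q apart-p apart-q {g} aut ext
      where
      c₀ : Fin n
      -- Any colour serves; that of a point of `Ω` shows that one exists.
      c₀ = col (proj₁ (proj₁ proper))

      parts : {K : Set} → MoreThanTwo K → Fin 3 → K
      parts (i , j , k , _) = triple i j k

      mono : {K : Set} {part : Ω → K} → Splitting D K part → (many : MoreThanTwo K) →
             ∀ k → ∃[ x ] (part x ≡ parts many k × col x ≡ c₀)
      mono split many k = sectors-meet-all-colours _ _ split (parts many k)
        (node-sector-infinite proper split many (parts many k)) c₀

      mono-apart : {K : Set} {part : Ω → K} (split : Splitting D K part) (many : MoreThanTwo K) →
                   ∀ i j → i ≢ j → part (proj₁ (mono split many i)) ≢ part (proj₁ (mono split many j))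
      mono-apart split many@(_ , _ , _ , uv , uw , vw) i j i≢j e =
        triple-≢ uv uw vw i j i≢j
          (trans (sym (proj₁ (proj₂ (mono split many i)))) (trans e (proj₁ (proj₂ (mono split many j)))))

      tp tq : Fin 3 → Ω
      tp k = proj₁ (mono split-p many-p k)
      tq k = proj₁ (mono split-q many-q k)

      apart-p : ∀ i j → i ≢ j → p (tp i) ≢ p (tp j)
      apart-p = mono-apart split-p many-p

      apart-q : ∀ i j → i ≢ j → q (tq i) ≢ q (tq j)
      apart-q = mono-apart split-q many-q

    Between : (w x y z v : Ω) → Set
    Between w x y z v = D v x y z × D w v y z × D w x v z × D w x y v

    bipartition : Fin 3 → Bool
    bipartition = triple false false true

    -- `z` hangs off the interior of the edge ending in `y`, so the other points form two branches
    -- there: `w`, `x` (possibly equal) and `y`.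
    edge-rooted : ∀ {w x y z} → D w x y z → y ≢ z →
                  Rooted (λ i j → bipartition i ≡ bipartition j) (triple w x y) z
    edge-rooted {w} {x} {y} {z} p y≢z = record
      { separates = separates
      ; unresolved = λ i j l ij il jl → ⊥-elim (Bool-no-three ij il jl)
      }
      where
      t : Fin 3 → Ω
      t = triple w x y
      first : ∀ i → bipartition i ≡ false → t i ≡ w ⊎ t i ≡ x
      first zero _ = inj₁ refl
      first (suc zero) _ = inj₂ refl
      first (suc (suc zero)) ()
      second : ∀ i → bipartition i ≡ true → t i ≡ y
      second zero ()
      second (suc zero) ()
      second (suc (suc zero)) _ = refl
      first-pair : ∀ {u v s} → u ≡ w ⊎ u ≡ x → v ≡ w ⊎ v ≡ x → s ≡ y → D u v z s
      first-pair (inj₁ refl) (inj₁ refl) refl = D4ʳ (D⇒w≢z p) (D⇒w≢y p)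
      first-pair (inj₁ refl) (inj₂ refl) refl = flipʳ p
      first-pair (inj₂ refl) (inj₁ refl) refl = flipˡ (flipʳ p)
      first-pair (inj₂ refl) (inj₂ refl) refl = D4ʳ (D⇒x≢z p) (D⇒x≢y p)
      second-pair : ∀ {u v s} → u ≡ y → v ≡ y → s ≡ w ⊎ s ≡ x → D u v z s
      second-pair refl refl (inj₁ refl) = D4ʳ y≢z (D⇒w≢y p ∘ sym)
      second-pair refl refl (inj₂ refl) = D4ʳ y≢z (D⇒x≢y p ∘ sym)
      separates : ∀ i j l → bipartition i ≡ bipartition j → bipartition i ≢ bipartition l →
                  D (t i) (t j) z (t l)
      separates i j l ij il with bipartition i in ei
      ... | false = first-pair (first i ei) (first j (sym ij)) (second l (¬-not (il ∘ sym)))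
      ... | true = second-pair (second i ei) (second j (sym ij)) (first l (¬-not (il ∘ sym)))

    -- Shrinking y, z to y′, z′ inside the branch of z at w, y, z makes y lie between w, x and y′, z′.
    between : ∀ {w x y z} → D w x y z → y ≢ z → ∃ (Between w x y z)
    between {w} {x} {y} {z} p y≢z
      with proj₂ proper w y z (D⇒w≢y p) (D⇒w≢z p) y≢z
    ... | t , t≢z , wy|zt
      -- At the node of `w`, `z`, `t`, the point `y′` is taken in the branch of `z` and `z′` in that
      -- of `t`, so they are distinct and both lie beyond `y`.
      with cone-colour proper sectors-meet-all-colours (D⇒w≢z wy|zt) (D⇒w≢z p) t≢z (col y)
         | cone-colour proper sectors-meet-all-colours (D⇒w≢z p) (D⇒w≢z wy|zt) (t≢z ∘ sym) (col z)
    ... | y′ , y′∈ , cy | z′ , z′∈ , cz =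
      let g , aut , ext = uh 4 (z′ ∷ᵛ triple w x y′) (z ∷ᵛ triple w x y) iso
          e₀ = ext zero
          e₁ = ext (suc zero)
          e₂ = ext (suc (suc zero))
          e₃ = ext (suc (suc (suc zero)))
      in Inverse.to g y ,
         automorphism-D {g} aut refl e₂ e₃ e₀ (swap (glue (flipʳ (swap wy|y′z′)) (swap wx|y′z′))) ,
         automorphism-D {g} aut e₁ refl e₃ e₀ wy|y′z′ ,
         automorphism-D {g} aut e₁ e₂ refl e₀ wx|yz′ ,
         automorphism-D {g} aut e₁ e₂ e₃ refl (flipʳ wx|yy′)
      where
      wy|zz : D w y z z
      wy|zz = D4 (D⇒w≢z p) y≢z
      wy|zy′ : D w y z y′
      wy|zy′ = cone-⊆ wy|zt wy|zz y′∈
      wy|zz′ : D w y z z′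
      wy|zz′ = cone-⊆ wy|zz wy|zt z′∈
      wy|y′z′ : D w y y′ z′
      wy|y′z′ = glue (flipʳ wy|zy′) wy|zz′
      wx|yy′ : D w x y y′
      wx|yy′ = glue p (nest p wy|zy′)
      wx|yz′ : D w x y z′
      wx|yz′ = glue p (nest p wy|zz′)
      wx|y′z′ : D w x y′ z′
      wx|y′z′ = glue (flipʳ wx|yy′) wx|yz′
      y′≢z′ : y′ ≢ z′
      y′≢z′ refl = D2 y′∈ z′∈
      eqs : EqIso (triple w x y′) (triple w x y)
      eqs zero zero = mk⇔ (λ _ → refl) (λ _ → refl)
      eqs zero (suc zero) = mk⇔ (λ e → e) (λ e → e)
      eqs zero (suc (suc zero)) = mk⇔ (λ e → ⊥-elim (D⇒w≢z wx|yy′ e)) (λ e → ⊥-elim (D⇒w≢y p e))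
      eqs (suc zero) zero = mk⇔ (λ e → e) (λ e → e)
      eqs (suc zero) (suc zero) = mk⇔ (λ _ → refl) (λ _ → refl)
      eqs (suc zero) (suc (suc zero)) = mk⇔ (λ e → ⊥-elim (D⇒x≢z wx|yy′ e)) (λ e → ⊥-elim (D⇒x≢y p e))
      eqs (suc (suc zero)) zero =
        mk⇔ (λ e → ⊥-elim (D⇒w≢z wx|yy′ (sym e))) (λ e → ⊥-elim (D⇒w≢y p (sym e)))
      eqs (suc (suc zero)) (suc zero) =
        mk⇔ (λ e → ⊥-elim (D⇒x≢z wx|yy′ (sym e))) (λ e → ⊥-elim (D⇒x≢y p (sym e)))
      eqs (suc (suc zero)) (suc (suc zero)) = mk⇔ (λ _ → refl) (λ _ → refl)
      other : ∀ i → ∃ λ k → bipartition i ≢ bipartition k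
      other zero = suc (suc zero) , λ ()
      other (suc zero) = suc (suc zero) , λ ()
      other (suc (suc zero)) = zero , λ ()
      iso : IsPartialIso D col (z′ ∷ᵛ triple w x y′) (z ∷ᵛ triple w x y)
      iso = rooted-partialIso (λ _ → refl) sym other
        (partialIso₃ eqs λ { zero → refl ; (suc zero) → refl ; (suc (suc zero)) → cy })
        cz (edge-rooted wx|y′z′ y′≢z′) (edge-rooted p y≢z)

    dense : Dense D
    dense with proj₁ proper
    ... | a , b , c , a≢b , a≢c , b≢c = (a , b , a≢b) , find
      where
      find : ∀ {w x y z} → D w x y z → ∃ (Between w x y z)
      find {w} {x} {y} {z} p with em {y ≡ z} | em {w ≡ x}
      ... | no y≢z | _ = between p y≢z
      ... | yes refl | no w≢x =
        let v , p₁ , p₂ , p₃ , p₄ = between (swap p) w≢x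
        in v , swap p₃ , swap p₄ , swap p₁ , swap p₂
      -- For `w = x` and `y = z`, any point different from both will do.
      ... | yes refl | yes refl
        with two-avoiding (λ i → triple a b c i ≡ w)
               (λ i j i≢j e f → triple-≢ a≢b a≢c b≢c i j i≢j (trans e (sym f)))
      ...   | i , j , i≢j , i≢w , j≢w = third (em {triple a b c i ≡ y})
        where
        good : ∀ {v} → v ≢ w → v ≢ y → ∃ (Between w w y y)
        good v≢w v≢y = _ , D4 v≢y (D⇒w≢y p) , D4 (D⇒w≢y p) v≢y ,
          D4ʳ (v≢w ∘ sym) (D⇒w≢y p) , D4ʳ (D⇒w≢y p) (v≢w ∘ sym)
        third : Dec (triple a b c i ≡ y) → ∃ (Between w w y y)
        third (no i≢y) = good i≢w i≢y
        third (yes i≡y) = good j≢w (λ j≡y → triple-≢ a≢b a≢c b≢c i j i≢j (trans i≡y (sym j≡y)))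

  -- The three conditions imply ultrahomogeneity

  -- Seen from b, the points at which the paths to the a k leave the path to r are linearly ordered.
  farthest : ∀ {m} (a : Fin m → Ω) (Q : Fin m → Set) (b r : Ω) → ∃ Q →
             ∃ λ j → Q j × (∀ k → Q k → ¬ D b (a j) r (a k))
  farthest {suc m} a Q b r (i , q) with em {∃ λ k → Q (suc k)}
  ... | no none = zero , only i q , λ
    { zero _ d → D⇒x≢z d refl
    ; (suc k) qk _ → none (k , qk) }
    where
    only : ∀ i → Q i → Q zero
    only zero q = q
    only (suc i) q = ⊥-elim (none (i , q))
  ... | yes some with farthest (a ∘ suc) (Q ∘ suc) b r some
  ...   | j , qj , max with em {Q zero × D b (a (suc j)) r (a zero)}
  ...     | no ¬beats = suc j , qj , λ
    { zero q₀ d → ¬beats (q₀ , d)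
    ; (suc k) qk d → max k qk d }
  ...     | yes (q₀ , beats) = zero , q₀ , λ
    { zero _ d → D⇒x≢z d refl
    ; (suc k) qk d → later k qk (D3 (flipˡ d) (a (suc j))) }
    where
    later : ∀ k → Q (suc k) → D (a (suc j)) b r (a (suc k)) ⊎ D (a zero) b r (a (suc j)) → ⊥
    later k qk (inj₁ d) = max k qk (flipˡ d)
    later k qk (inj₂ d) = D2 (flipʳ (flipˡ d)) (flipʳ beats)

  module ToUltrahomogeneous (count : Countable Ω) (proper : Proper D) (dense : Dense D)
                            (regular : Regular D) (meets : SectorsMeetAllColours) where

    -- A cone seen from `p` omits `p` and meets every colour.
    another : ∀ p c → ∃[ y ] (y ≢ p × col y ≡ c)
    another p c with proj₁ proper
    ... | t₀ , t₁ , t₂ , ≢₀₁ , ≢₀₂ , ≢₁₂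
      with two-avoiding (λ i → p ≡ triple t₀ t₁ t₂ i)
             (λ i j i≢j e f → triple-≢ ≢₀₁ ≢₀₂ ≢₁₂ i j i≢j (trans (sym e) f))
    ... | i , j , i≢j , p≢i , p≢j
      with cone-colour proper meets p≢i p≢j (triple-≢ ≢₀₁ ≢₀₂ ≢₁₂ i j i≢j) c
    ... | y , d , e = y , D⇒w≢z d ∘ sym , e

    -- One-point extension of a finite partial isomorphism.

    module OnePoint {m : ℕ} {a b : Fin m → Ω} (iso : IsPartialIso D col a b)
                    {x : Ω} (x∉ : ∀ k → x ≢ a k) where

      D-a⇒b : ∀ {i j k l} → D (a i) (a j) (a k) (a l) → D (b i) (b j) (b k) (b l)
      D-a⇒b = to (proj₂ (proj₂ iso) _ _ _ _)

      D-b⇒a : ∀ {i j k l} → D (b i) (b j) (b k) (b l) → D (a i) (a j) (a k) (a l)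
      D-b⇒a = from (proj₂ (proj₂ iso) _ _ _ _)

      Extension : Set
      Extension = ∃[ y ] IsPartialIso D col (x ∷ᵛ a) (y ∷ᵛ b)

      -- With at most one old point, only the colour and distinctness of the image matter.
      extend-constant : (∀ i j → a i ≡ a j) → Extension
      extend-constant constant with avoid
        where
        avoid : ∃[ y ] (col x ≡ col y × (∀ k → y ≢ b k))
        avoid with em {Fin m}
        ... | no empty = x , refl , λ k → ⊥-elim (empty k)
        ... | yes i =
          let y , y≢ , e = another (b i) (col x)
          in y , sym e , λ k y≡bk → y≢ (trans y≡bk (to (proj₁ iso k i) (constant k i)))
      ... | y , cxy , y∉ = y , partialIso-∷ iso cxy x∉ y∉
        (λ i j k d → ⊥-elim (D⇒w≢z d (constant i k)))
        (λ i j k d → ⊥-elim (D⇒w≢z d (to (proj₁ iso i k) (constant i k))))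

      -- Being in one branch at the vertex where `x` attaches, expressed without naming the vertex:
      -- the path between the two points avoids the path from `x` to some old point.
      R : Fin m → Fin m → Set
      R i j = ∃ λ k → D (a i) (a j) x (a k)

      R-sym : ∀ {i j} → R i j → R j i
      R-sym (k , d) = k , flipˡ d

      R-trans : ∀ {i j l} → R i j → R j l → R i l
      R-trans (k , d) (k′ , d′) with merge d d′
      ... | inj₁ e = k , e
      ... | inj₂ e = k′ , e

      -- The point branching off last on the way from `a i` to `x` does so where `x` attaches, hence
      -- lies in another branch.
      R-other : ∀ i → ∃ λ k → ¬ R i k
      R-other i with farthest a (λ k → k ≡ k) (a i) x (i , refl)
      ... | j , _ , max = j , λ (k , d) → max k refl d

      rooted-a : Rooted R a x
      rooted-a = record
        { separates = separates
        ; unresolved = λ i j l ¬ij _ _ d → ¬ij (l , d)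
        }
        where
        separates : ∀ i j l → R i j → ¬ R i l → D (a i) (a j) x (a l)
        separates i j l (k , d) ¬il with D3 d (a l)
        ... | inj₁ e = ⊥-elim (¬il (R-trans (k , d) (R-sym (k , e))))
        ... | inj₂ e = e

      open Rooted rooted-a

      R-refl : ∀ {i₀ j₀} → a i₀ ≢ a j₀ → ∀ i → R i i
      R-refl {i₀} {j₀} i₀≢j₀ i with em {a i ≡ a i₀}
      ... | no i≢i₀ = i₀ , D4ʳ (x∉ i ∘ sym) i≢i₀
      ... | yes i≡i₀ = j₀ , D4ʳ (x∉ i ∘ sym) (λ i≡j₀ → i₀≢j₀ (trans (sym i≡i₀) i≡j₀))

      -- Exactly two branches of old points: `x` hangs off the interior of an edge.
      module Edge (R-refl : ∀ i → R i i) {i₀ j₀ : Fin m} (¬i₀j₀ : ¬ R i₀ j₀)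
                  (cover : ∀ l → R i₀ l ⊎ R j₀ l) where

        across : ∀ {i i′ j j′} → R i i′ → ¬ R i j → ¬ R i j′ → D (b i) (b i′) (b j) (b j′)
        across r ¬r ¬r′ = D-a⇒b (glue (flipʳ (separates _ _ _ r ¬r)) (separates _ _ _ r ¬r′))

        -- On the way from `p` to `q`, `d` leaves no later than `p₂`, which leaves before `v`, and
        -- `y` leaves together with `v`.
        toward : ∀ {p p₂ q v y d} → D p p₂ q v → D p q v y → ¬ D p p₂ q d → D p d q y
        toward {p} {p₂} {q} {v} {y} {d} pp₂|qv pq|vy ¬pp₂|qd with D3 pp₂|qv d
        ... | inj₂ e = ⊥-elim (¬pp₂|qd e)
        ... | inj₁ dp₂|qv with D3 (flipˡ (glue (swap pp₂|qv) (flipʳ (swap dp₂|qv)))) y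
        ...   | inj₁ e = flipʳ (swap e)
        ...   | inj₂ e = ⊥-elim (D2 (flipˡ e) (flipˡ pq|vy))

        Half : Fin m → Fin m → Ω → Set
        Half i j y = ∀ {k} → R i k → D (b i) (b k) (b j) y

        extend : Extension
        extend with farthest b (R i₀) (b i₀) (b j₀) (i₀ , R-refl i₀)
                  | farthest b (R j₀) (b j₀) (b i₀) (j₀ , R-refl j₀)
        ... | i₂ , i₀i₂ , i-max | j₂ , j₀j₂ , j-max
          -- `i₂` and `j₂` mark the two ends of the edge on the path from `b i₀` to `b j₀`; density
          -- yields `v` leaving that path strictly between them.
          with proj₂ dense (across i₀i₂ ¬i₀j₀ (λ r → ¬i₀j₀ (R-trans r (R-sym j₀j₂))))
        ... | v , _ , i₀v|j₀j₂ , _ , i₀i₂|j₀v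
          -- `v` marks the place but may have the wrong colour; its branch off the path contains a
          -- point coloured like `x`.
          with cone-colour proper meets (D⇒w≢y i₀v|j₀j₂) (D⇒w≢z i₀i₂|j₀v) (D⇒x≢y i₀v|j₀j₂ ∘ sym) (col x)
        ... | y , i₀j₀|vy , cy =
          y , rooted-partialIso R-refl R-sym R-other iso (sym cy) rooted-a
                (record { separates = rooted ; unresolved = λ i j l ¬ij ¬il ¬jl → ⊥-elim (third i j l ¬ij ¬il ¬jl) })
          where
          half-i : Half i₀ j₀ y
          half-i r = toward i₀i₂|j₀v i₀j₀|vy (i-max _ r)
          half-j : Half j₀ i₀ y
          half-j r = toward (swap i₀v|j₀j₂) (flipˡ i₀j₀|vy) (j-max _ r)
          side : ∀ {i j} → ¬ R i j → Half i j y → ∀ {k k′ l} → R i k → R i k′ → R j l → D (b k) (b k′) y (b l)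
          side ¬ij half rk rk′ rl =
            glue (swap (glue (flipʳ (flipˡ (swap (half rk)))) (flipˡ (swap (half rk′)))))
                 (across (R-trans (R-sym rk) rk′) (λ r → ¬ij (R-trans rk r))
                    (λ r → ¬ij (R-trans rk (R-trans r (R-sym rl)))))
          rooted : ∀ i j l → R i j → ¬ R i l → D (b i) (b j) y (b l)
          rooted i j l ij ¬il with cover i | cover l
          ... | inj₁ ri | inj₁ rl = ⊥-elim (¬il (R-trans (R-sym ri) rl))
          ... | inj₂ ri | inj₂ rl = ⊥-elim (¬il (R-trans (R-sym ri) rl))
          ... | inj₁ ri | inj₂ rl = side ¬i₀j₀ half-i ri (R-trans ri ij) rl
          ... | inj₂ ri | inj₁ rl = side (¬i₀j₀ ∘ R-sym) half-j ri (R-trans ri ij) rl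
          third : ∀ i j l → ¬ R i j → ¬ R i l → ¬ R j l → ⊥
          third i j l ¬ij ¬il ¬jl with cover i | cover j | cover l
          ... | inj₁ ri | inj₁ rj | _ = ¬ij (R-trans (R-sym ri) rj)
          ... | inj₁ ri | inj₂ _ | inj₁ rl = ¬il (R-trans (R-sym ri) rl)
          ... | inj₁ _ | inj₂ rj | inj₂ rl = ¬jl (R-trans (R-sym rj) rl)
          ... | inj₂ ri | inj₂ rj | _ = ¬ij (R-trans (R-sym ri) rj)
          ... | inj₂ ri | inj₁ _ | inj₂ rl = ¬il (R-trans (R-sym ri) rl)
          ... | inj₂ _ | inj₁ rj | inj₁ rl = ¬jl (R-trans (R-sym rj) rl)

      -- Three branches of old points: the vertex is a node determined by old points alone, so it
      -- has a counterpart among the images.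
      module Node (R-refl : ∀ i → R i i) (ι : Fin 3 → Fin m)
                  (apart : ∀ i j → i ≢ j → ¬ R (ι i) (ι j)) where

        ta tb : Fin 3 → Ω
        ta = a ∘ ι
        tb = b ∘ ι

        ta-distinct : ∀ i j → i ≢ j → ta i ≢ ta j
        ta-distinct i j i≢j e =
          let k , d = R-refl (ι i)
          in apart i j i≢j (k , subst (λ u → D (ta i) u x (a k)) e d)

        tb-distinct : ∀ i j → i ≢ j → tb i ≢ tb j
        tb-distinct i j i≢j e = ta-distinct i j i≢j (from (proj₁ iso _ _) e)

        -- `R` refers to `x`, whereas `SameBranch ta` between old points does not and so transfers
        -- to `b`.
        R⇒SameBranch : ∀ {j k} → R j k → SameBranch ta (a j) (a k)
        R⇒SameBranch {j} {k} r
          with two-avoiding (λ i → R j (ι i)) (λ i i′ i≢i′ p q → apart i i′ i≢i′ (R-trans (R-sym p) q))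
        ... | u , v , u≢v , ¬u , ¬v =
          u , v , u≢v , glue (flipʳ (separates _ _ _ r ¬u)) (separates _ _ _ r ¬v)

        SameBranch⇒R : ∀ {j k} → SameBranch ta (a j) (a k) → R j k
        SameBranch⇒R (u , v , u≢v , d) with D3 d x
        ... | inj₁ e = ⊥-elim (apart u v u≢v (_ , swap e))
        ... | inj₂ e = _ , flipʳ e

        a⇒b : ∀ {j k} → SameBranch ta (a j) (a k) → SameBranch tb (b j) (b k)
        a⇒b (u , v , u≢v , d) = u , v , u≢v , D-a⇒b d

        b⇒a : ∀ {j k} → SameBranch tb (b j) (b k) → SameBranch ta (a j) (a k)
        b⇒a (u , v , u≢v , d) = u , v , u≢v , D-b⇒a d

        x-apart : ∀ {k} → ¬ SameBranch ta x (a k)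
        x-apart (u , v , u≢v , d) = apart u v u≢v (_ , swap d)

        module _ (A : NodeSplitting ta) (B : NodeSplitting tb) where

          private
            module A = NodeSplitting A
            module B = NodeSplitting B

          -- The branch of `x` at the node of `ta` contains no old point. Regularity matches the
          -- branches of the two nodes in number, and old points sharing a branch on one side share
          -- one on the other, so they cannot occupy every branch at the node of `tb`.
          fresh-branch : ∃ λ y → ∀ k → ¬ SameBranch tb y (b k)
          fresh-branch with em {∃ λ y → ∀ k → ¬ SameBranch tb y (b k)}
          ... | yes found = found
          ... | no none = ⊥-elim (misses-transfer
                  (regular A.Class B.Class A.class B.class A.splitting A.moreThanTwo B.splitting B.moreThanTwo)
                  (A.class ∘ a) (B.class ∘ b) (λ e → B.class-cong (a⇒b (A.class-eq e)))
                  (A.class x) (λ k e → x-apart (A.class-eq (sym e))) hit)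
            where
            hit : ∀ c → ∃ λ k → B.class (b k) ≡ c
            hit c with Splitting.surjective B.splitting c
            ... | y , refl with em {∃ λ k → SameBranch tb y (b k)}
            ...   | yes (k , s) = k , sym (B.class-cong s)
            ...   | no ¬h = ⊥-elim (none (y , λ k s → ¬h (k , s)))

          extend-at : Extension
          extend-at with fresh-branch
          ... | y₀ , y₀-fresh
            -- `y₀` only selects the branch; the colour is found inside it.
            with meets B.Class B.class B.splitting (B.class y₀)
                   (node-sector-infinite proper B.splitting B.moreThanTwo (B.class y₀)) (col x)
          ... | y , y~y₀ , cy = y , rooted-partialIso R-refl R-sym R-other iso (sym cy) rooted-a
            (record
              { separates = λ i j l ij ¬il → SameBranch-split-i {tb} (a⇒b (R⇒SameBranch ij))
                  (λ s → y-fresh i (SameBranch-sym {tb} s)) (λ s → ¬il (SameBranch⇒R (b⇒a s)))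
              ; unresolved = λ i j l ¬ij _ _ →
                  SameBranch-split-ii {tb} (λ s → ¬ij (SameBranch⇒R (b⇒a s))) (y-fresh l)
              })
            where
            y-fresh : ∀ k → ¬ SameBranch tb y (b k)
            y-fresh k s = y₀-fresh k (SameBranch-trans {tb} (SameBranch-sym {tb} (B.class-eq y~y₀)) s)

        extend : Extension
        extend = extend-at (nodeSplitting count ta ta-distinct) (nodeSplitting count tb tb-distinct)

      -- Once two old points differ, a third branch of old points distinguishes attachment at a node
      -- from attachment inside an edge.
      extension : Extension
      extension with em {∃ λ i → ∃ λ j → a i ≢ a j}
      ... | no none = extend-constant constant
        where
        constant : ∀ i j → a i ≡ a j
        constant i j with em {a i ≡ a j}
        ... | yes e = e
        ... | no i≢j = ⊥-elim (none (i , j , i≢j))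
      ... | yes (i₀ , _ , i₀≢) with R-other i₀
      ...   | j₀ , ¬i₀j₀ with em {∃ λ l → ¬ R i₀ l × ¬ R j₀ l}
      ...     | yes (l₀ , ¬i₀l₀ , ¬j₀l₀) = Node.extend (R-refl i₀≢) (triple i₀ j₀ l₀)
        (triple-pairwise (λ i j → ¬ R i j) (_∘ R-sym) ¬i₀j₀ ¬i₀l₀ ¬j₀l₀)
      ...     | no none = Edge.extend (R-refl i₀≢) ¬i₀j₀ cover
        where
        cover : ∀ l → R i₀ l ⊎ R j₀ l
        cover l with em {R i₀ l} | em {R j₀ l}
        ... | yes r | _ = inj₁ r
        ... | no _ | yes r = inj₂ r
        ... | no ¬r | no ¬r′ = ⊥-elim (none (l , ¬r , ¬r′))

    -- Back-and-forth.

    record Stage : Set where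
      constructor stage
      field
        {size} : ℕ
        {a b} : Fin size → Ω
        iso : IsPartialIso D col a b

    Graph : Stage → Ω → Ω → Set
    Graph S x y = ∃ λ i → Stage.a S i ≡ x × Stage.b S i ≡ y

    inverse : Stage → Stage
    inverse (stage iso) = stage (partialIso-sym iso)

    inverse-graph : ∀ {S x y} → Graph S x y → Graph (inverse S) y x
    inverse-graph (i , p , q) = i , q , p

    _⊑_ : Stage → Stage → Set
    S ⊑ T = ∀ {x y} → Graph S x y → Graph T x y

    forth : ∀ S x → ∃ λ T → S ⊑ T × ∃ λ y → Graph T x y
    forth S@(stage {a = a} {b} iso) x with em {∃ λ k → a k ≡ x}
    ... | yes (k , e) = S , (λ g → g) , b k , k , e , refl
    ... | no x∉ with OnePoint.extension iso {x} (λ k e → x∉ (k , sym e))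
    ...   | y , iso⁺ = stage iso⁺ , (λ (i , p , q) → suc i , p , q) , y , zero , refl , refl

    back : ∀ S y → ∃ λ T → S ⊑ T × ∃ λ x → Graph T x y
    back S y with forth (inverse S) y
    ... | T , S⊑T , x , g =
      inverse T , (λ g → inverse-graph {T} (S⊑T (inverse-graph {S} g))) , x , inverse-graph {T} g

    code : Ω → ℕ
    code = Injection.to count

    -- The point with code `t`, if there is one, enters first the domain and then the range.
    step : ∀ S t → ∃ λ T → S ⊑ T ×
           (∀ x → code x ≡ t → (∃ λ y → Graph T x y) × (∃ λ y → Graph T y x))
    step S t with em {∃ λ x → code x ≡ t}
    ... | no none = S , (λ g → g) , λ x e → ⊥-elim (none (x , e))
    ... | yes (x , e) with forth S x
    ...   | T , S⊑T , y , g with back T x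
    ...     | U , T⊑U , y′ , g′ = U , (λ h → T⊑U (S⊑T h)) , covers
      where
      covers : ∀ z → code z ≡ t → (∃ λ y → Graph U z y) × (∃ λ y → Graph U y z)
      covers z e′ with Injection.injective count (trans e′ (sym e))
      ... | refl = (y , T⊑U g) , (y′ , g′)

    module Limit (S₀ : Stage) where

      stages : ℕ → Stage
      stages zero = S₀
      stages (suc t) = proj₁ (step (stages t) t)

      stages-mono : ∀ {s t} → s ≤′ t → stages s ⊑ stages t
      stages-mono ≤′-refl g = g
      stages-mono {t = suc t} (≤′-step s≤t) g = proj₁ (proj₂ (step (stages t) t)) (stages-mono s≤t g)

      G : Ω → Ω → Set
      G x y = ∃ λ t → Graph (stages t) x y

      raise : ∀ {s t x y} → s ≤ t → Graph (stages s) x y → Graph (stages t) x y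
      raise s≤t = stages-mono (≤⇒≤′ s≤t)

      G-total : ∀ x → ∃ λ y → G x y
      G-total x with proj₁ (proj₂ (proj₂ (step (stages (code x)) (code x))) x refl)
      -- The point with code `t` is treated in passing from stage `t` to stage `t + 1`.
      ... | y , g = y , suc (code x) , g

      G-surjective : ∀ y → ∃ λ x → G x y
      G-surjective y with proj₂ (proj₂ (proj₂ (step (stages (code y)) (code y))) y refl)
      ... | x , g = x , suc (code y) , g

      G-≡ : ∀ {x y x′ y′} → G x y → G x′ y′ → x ≡ x′ ⇔ y ≡ y′
      G-≡ (s , g) (t , g′)
        with stages (s ⊔ t) | raise (m≤m⊔n s t) g | raise (m≤n⊔m s t) g′
      ... | stage iso | i , refl , refl | j , refl , refl = proj₁ iso i j

      G-colour : ∀ {x y} → G x y → col x ≡ col y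
      G-colour (t , i , refl , refl) = proj₁ (proj₂ (Stage.iso (stages t))) i

      -- All four pairs already belong to one finite stage, at the maximum of their indices.
      G-D : ∀ {x₁ x₂ x₃ x₄ y₁ y₂ y₃ y₄} → G x₁ y₁ → G x₂ y₂ → G x₃ y₃ → G x₄ y₄ →
            D x₁ x₂ x₃ x₄ ⇔ D y₁ y₂ y₃ y₄
      G-D (s , g) (t , h) (s′ , g′) (t′ , h′)
        with stages ((s ⊔ t) ⊔ (s′ ⊔ t′))
           | raise (≤-trans (m≤m⊔n s t) (m≤m⊔n (s ⊔ t) (s′ ⊔ t′))) g
           | raise (≤-trans (m≤n⊔m s t) (m≤m⊔n (s ⊔ t) (s′ ⊔ t′))) h
           | raise (≤-trans (m≤m⊔n s′ t′) (m≤n⊔m (s ⊔ t) (s′ ⊔ t′))) g′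
           | raise (≤-trans (m≤n⊔m s′ t′) (m≤n⊔m (s ⊔ t) (s′ ⊔ t′))) h′
      ... | stage iso | i , refl , refl | j , refl , refl | k , refl , refl | l , refl , refl =
        proj₂ (proj₂ iso) i j k l

      automorphism : Ω ↔ Ω
      automorphism = mk↔ₛ′ (λ x → proj₁ (G-total x)) (λ y → proj₁ (G-surjective y))
        (λ y → to (G-≡ (proj₂ (G-total _)) (proj₂ (G-surjective y))) refl)
        (λ x → from (G-≡ (proj₂ (G-surjective _)) (proj₂ (G-total x))) refl)

    ultrahomogeneous : Ultrahomogeneous D col
    ultrahomogeneous m a b iso = automorphism ,
      ((λ x → sym (G-colour (proj₂ (G-total x)))) ,
       (λ w x y z → G-D (proj₂ (G-total w)) (proj₂ (G-total x)) (proj₂ (G-total y)) (proj₂ (G-total z)))) ,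
      (λ i → to (G-≡ (proj₂ (G-total (a i))) (0 , i , refl , refl)) refl)
      where open Limit (stage iso)

theorem1 : ExcludedMiddle 0ℓ →
    (Ω : Set) (D : Rel₄ Ω) (n : ℕ) (P : Colouring Ω n) →
    Countable Ω → IsDSet D → Proper D →
    Ultrahomogeneous D (proj₁ P) ⇔
    (Dense D × Regular D ×
    (∀ (I : Set) (part : Ω → I) → Splitting D I part →
    ∀ (s : I) → Infinite (λ x → part x ≡ s) →
    ∀ c → ∃[ x ] (part x ≡ s × proj₁ P x ≡ c)))
theorem1 em Ω D n (col , inhabited) count isD proper = mk⇔
  (λ uh → let open FromUltrahomogeneous proper inhabited uh
          in dense , regular , sectors-meet-all-colours)
  (λ (dense , regular , meets) →
    ToUltrahomogeneous.ultrahomogeneous count proper dense regular meets)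
  where open Coloured em isD col
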